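{- Let $N\ge 2$ and $s\ge 1$ be integers and let $W=\ldots \alpha_{s-1} \alpha_0 \alpha_1 \ldots \alpha_{s-1} \alpha_0 \alpha_1 \ldots$ be an infinite $s$-periodic word with letters in $\mathbb{Z} / N \mathbb{Z}$. Then there exists a smallest positive integer $t$ such that all subwords of length $ts-1$ in $W$ belong to $\bar{\mathcal{A}}$. Moreover, for this $t$, all subwords of length $lts-1$ of $W$ belong to $\bar{\mathcal{A}}$ for every integer $l \geq 1$.
   Context: $F_N$ is the free monoid of all finite words with letters in $\mathbb{Z}/N\mathbb{Z}$ (identity: the empty word $\varepsilon$); juxtaposition of letters is concatenation. $\pi : F_N \to \mathrm{SL}_2(\mathbb{Z}/N\mathbb{Z})$ is the monoid homomorphism with $\pi(\alpha) = \begin{bmatrix} 0 & 1 \\ -1 & \alpha \end{bmatrix}$ for each letter $\alpha$, so $\pi(\alpha_1\cdots\alpha_l)=\pi(\alpha_1)\cdots\pi(\alpha_l)$ and $\pi(\varepsilon)$ is the identity matrix. On $(\mathbb{Z}/N\mathbb{Z})^2\smallsetminus\{0\}$ (column vectors) let $u\sim' v$ if and only if $u=\lambda v$ for some $\lambda\in(\mathbb{Z}/N\mathbb{Z})^\times$; $\mathrm{SL}_2(\mathbb{Z}/N\mathbb{Z})$ acts on the set of $\sim'$-classes by left multiplication. $\bar{\mathcal{A}} = \left\{w \in F_N : \pi(w)\begin{bmatrix} 0 \\ 1 \end{bmatrix} = \begin{bmatrix} 1 \\ 0 \end{bmatrix} \text{ as } \sim'\text{ -classes}\right\}$. An infinite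 word is a bi-infinite sequence of letters indexed by $\mathbb{Z}$; it is $s$-periodic when it is the bi-infinite repetition of a block $\alpha_0\alpha_1\cdots\alpha_{s-1}$ (i.e. letters at positions $i$ and $i+s$ agree for all $i\in\mathbb{Z}$). A subword of length $m$ of $W$ is a word formed by $m$ consecutive letters of $W$ (the empty word if $m=0$). -}

module Defs where

open import Algebra.Bundles using (CommutativeRing)
import Algebra.Definitions as AlgebraDefinitions
import Algebra.Properties.Ring as RingProperties
import Algebra.Solver.Ring.NaturalCoefficients.Default as SemiringSolver
open import Algebra.Structures using (IsCommutativeRing)
open import Data.Fin.Base using (Fin; toℕ)
open import Data.Fin.Properties using (toℕ-injective; toℕ-fromℕ<; toℕ<n; toℕ≤n)
open import Data.Integer.Base as ℤ using (ℤ; +_)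
open import Data.List.Base using (List; applyUpTo; foldr)
open import Data.Nat.Base as ℕ using (ℕ; NonZero; NonTrivial; _<_; _≤_)
open import Data.Nat.DivMod
  using (_%_; _mod_; m%n<n; m<n⇒m%n≡m; n%n≡0; m%n%n≡m%n; %-distribˡ-+; %-distribˡ-*)
import Data.Nat.Properties as ℕ
open import Data.Product.Base using (_×_; _,_; proj₁; proj₂; ∃-syntax)
open import Level using (0ℓ)
open import Relation.Binary.PropositionalEquality
  using (_≡_; _≢_; sym; trans; cong; cong₂; isEquivalence; module ≡-Reasoning)
import Relation.Binary.Reasoning.Setoid as SetoidReasoning
open import Relation.Nullary.Negation.Core using (contradiction)
open import Relation.Unary using (Pred; _∈_)

-- ℤ/Nℤ, its elements being the representatives 0, …, N-1.
ℤmod : ℕ → Set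
ℤmod N = Fin N

module _ (N : ℕ) .{{nz : NonZero N}} where

  private
    ⟦_⟧ : ℕ → ℤmod N
    ⟦ k ⟧ = k mod N

    _⊕_ _⊗_ : ℤmod N → ℤmod N → ℤmod N
    a ⊕ b = ⟦ toℕ a ℕ.+ toℕ b ⟧
    a ⊗ b = ⟦ toℕ a ℕ.* toℕ b ⟧

    ⊖_ : ℤmod N → ℤmod N
    ⊖ a = ⟦ N ℕ.∸ toℕ a ⟧

    toℕ-⟦⟧ : ∀ k → toℕ ⟦ k ⟧ ≡ k % N
    toℕ-⟦⟧ k = toℕ-fromℕ< (m%n<n k N)

    ⟦⟧-cong% : ∀ {j k} → j % N ≡ k % N → ⟦ j ⟧ ≡ ⟦ k ⟧
    ⟦⟧-cong% {j} {k} eq =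
      toℕ-injective (trans (toℕ-⟦⟧ j) (trans eq (sym (toℕ-⟦⟧ k))))

    ⟦toℕ⟧ : ∀ a → ⟦ toℕ a ⟧ ≡ a
    ⟦toℕ⟧ a = toℕ-injective (trans (toℕ-⟦⟧ (toℕ a)) (m<n⇒m%n≡m (toℕ<n a)))

    ⟦⟧%% : ∀ j → toℕ ⟦ j ⟧ % N ≡ j % N
    ⟦⟧%% j = trans (cong (_% N) (toℕ-⟦⟧ j)) (m%n%n≡m%n j N)

    +-absorbˡ : ∀ j k → ⟦ toℕ ⟦ j ⟧ ℕ.+ k ⟧ ≡ ⟦ j ℕ.+ k ⟧
    +-absorbˡ j k = ⟦⟧-cong% (begin
      (toℕ ⟦ j ⟧ ℕ.+ k) % N              ≡⟨ %-distribˡ-+ (toℕ ⟦ j ⟧) k N ⟩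
      (toℕ ⟦ j ⟧ % N ℕ.+ k % N) % N      ≡⟨ cong (λ z → (z ℕ.+ k % N) % N) (⟦⟧%% j) ⟩
      (j % N ℕ.+ k % N) % N              ≡⟨ %-distribˡ-+ j k N ⟨
      (j ℕ.+ k) % N                      ∎)
      where open ≡-Reasoning

    +-absorbʳ : ∀ j k → ⟦ j ℕ.+ toℕ ⟦ k ⟧ ⟧ ≡ ⟦ j ℕ.+ k ⟧
    +-absorbʳ j k = trans (cong ⟦_⟧ (ℕ.+-comm j _))
      (trans (+-absorbˡ k j) (cong ⟦_⟧ (ℕ.+-comm k j)))

    *-absorbˡ : ∀ j k → ⟦ toℕ ⟦ j ⟧ ℕ.* k ⟧ ≡ ⟦ j ℕ.* k ⟧
    *-absorbˡ j k = ⟦⟧-cong% (begin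
      (toℕ ⟦ j ⟧ ℕ.* k) % N              ≡⟨ %-distribˡ-* (toℕ ⟦ j ⟧) k N ⟩
      ((toℕ ⟦ j ⟧ % N) ℕ.* (k % N)) % N  ≡⟨ cong (λ z → (z ℕ.* (k % N)) % N) (⟦⟧%% j) ⟩
      ((j % N) ℕ.* (k % N)) % N          ≡⟨ %-distribˡ-* j k N ⟨
      (j ℕ.* k) % N                      ∎)
      where open ≡-Reasoning

    *-absorbʳ : ∀ j k → ⟦ j ℕ.* toℕ ⟦ k ⟧ ⟧ ≡ ⟦ j ℕ.* k ⟧
    *-absorbʳ j k = trans (cong ⟦_⟧ (ℕ.*-comm j _))
      (trans (*-absorbˡ k j) (cong ⟦_⟧ (ℕ.*-comm k j)))

    ⊕-comm : ∀ a b → a ⊕ b ≡ b ⊕ a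
    ⊕-comm a b = cong ⟦_⟧ (ℕ.+-comm (toℕ a) (toℕ b))

    ⊗-comm : ∀ a b → a ⊗ b ≡ b ⊗ a
    ⊗-comm a b = cong ⟦_⟧ (ℕ.*-comm (toℕ a) (toℕ b))

    ⊕-assoc : ∀ a b c → (a ⊕ b) ⊕ c ≡ a ⊕ (b ⊕ c)
    ⊕-assoc a b c = trans (+-absorbˡ _ (toℕ c))
      (trans (cong ⟦_⟧ (ℕ.+-assoc (toℕ a) (toℕ b) (toℕ c))) (sym (+-absorbʳ (toℕ a) _)))

    ⊗-assoc : ∀ a b c → (a ⊗ b) ⊗ c ≡ a ⊗ (b ⊗ c)
    ⊗-assoc a b c = trans (*-absorbˡ _ (toℕ c))
      (trans (cong ⟦_⟧ (ℕ.*-assoc (toℕ a) (toℕ b) (toℕ c))) (sym (*-absorbʳ (toℕ a) _)))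

    ⊕-identityˡ : ∀ a → ⟦ 0 ⟧ ⊕ a ≡ a
    ⊕-identityˡ a = trans (+-absorbˡ 0 (toℕ a)) (⟦toℕ⟧ a)

    ⊗-identityˡ : ∀ a → ⟦ 1 ⟧ ⊗ a ≡ a
    ⊗-identityˡ a = trans (*-absorbˡ 1 (toℕ a))
      (trans (cong ⟦_⟧ (ℕ.*-identityˡ (toℕ a))) (⟦toℕ⟧ a))

    ⊖-inverseʳ : ∀ a → a ⊕ (⊖ a) ≡ ⟦ 0 ⟧
    ⊖-inverseʳ a = trans (+-absorbʳ (toℕ a) _)
      (trans (cong ⟦_⟧ (ℕ.m+[n∸m]≡n (toℕ≤n a))) (⟦⟧-cong% (trans (n%n≡0 N) (sym 0%N))))
      where
      0%N : 0 % N ≡ 0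
      0%N = m<n⇒m%n≡m (ℕ.>-nonZero⁻¹ N)

    ⊗-distribˡ : ∀ a b c → a ⊗ (b ⊕ c) ≡ (a ⊗ b) ⊕ (a ⊗ c)
    ⊗-distribˡ a b c = begin
      ⟦ toℕ a ℕ.* toℕ ⟦ toℕ b ℕ.+ toℕ c ⟧ ⟧             ≡⟨ *-absorbʳ (toℕ a) _ ⟩
      ⟦ toℕ a ℕ.* (toℕ b ℕ.+ toℕ c) ⟧                    ≡⟨ cong ⟦_⟧ (ℕ.*-distribˡ-+ (toℕ a) (toℕ b) (toℕ c)) ⟩
      ⟦ toℕ a ℕ.* toℕ b ℕ.+ toℕ a ℕ.* toℕ c ⟧           ≡⟨ +-absorbˡ _ _ ⟨
      ⟦ toℕ (a ⊗ b) ℕ.+ toℕ a ℕ.* toℕ c ⟧               ≡⟨ +-absorbʳ (toℕ (a ⊗ b)) _ ⟨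
      (a ⊗ b) ⊕ (a ⊗ c)                                  ∎
      where open ≡-Reasoning

    isCommutativeRing : IsCommutativeRing _≡_ _⊕_ _⊗_ ⊖_ ⟦ 0 ⟧ ⟦ 1 ⟧
    isCommutativeRing = record
      { isRing = record
        { +-isAbelianGroup = record
          { isGroup = record
            { isMonoid = record
              { isSemigroup = record
                { isMagma = record { isEquivalence = isEquivalence ; ∙-cong = cong₂ _⊕_ }
                ; assoc = ⊕-assoc }
              ; identity = ⊕-identityˡ , λ a → trans (⊕-comm a _) (⊕-identityˡ a) }
            ; inverse = (λ a → trans (⊕-comm _ a) (⊖-inverseʳ a)) , ⊖-inverseʳ
            ; ⁻¹-cong = cong ⊖_ }
          ; comm = ⊕-comm }
        ; *-cong = cong₂ _⊗_
        ; *-assoc = ⊗-assoc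
        ; *-identity = ⊗-identityˡ , λ a → trans (⊗-comm a _) (⊗-identityˡ a)
        ; distrib = ⊗-distribˡ , λ a b c → trans (⊗-comm _ a)
            (trans (⊗-distribˡ a b c) (cong₂ _⊕_ (⊗-comm a b) (⊗-comm a c))) }
      ; *-comm = ⊗-comm }

  ℤmod-commutativeRing : CommutativeRing 0ℓ 0ℓ
  ℤmod-commutativeRing = record { isCommutativeRing = isCommutativeRing }

private
  module Identities {c ℓ} (R : CommutativeRing c ℓ) where

    open CommutativeRing R
    open SemiringSolver commutativeSemiring

    split : ∀ a b c d a′ b′ c′ d′ →
      (a * a′ + b * c′) * (c * b′ + d * d′)
        ≈ (a * d) * (a′ * d′) + ((b * c) * (b′ * c′) + (a * c * (a′ * b′) + b * d * (c′ * d′)))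
    split = solve 8 (λ a b c d a′ b′ c′ d′ →
      (a :* a′ :+ b :* c′) :* (c :* b′ :+ d :* d′)
        := (a :* d) :* (a′ :* d′) :+ ((b :* c) :* (b′ :* c′) :+ (a :* c :* (a′ :* b′) :+ b :* d :* (c′ :* d′)))) refl

    collect : ∀ a b c d a′ b′ c′ d′ →
      (a * d) * (b′ * c′) + (b * c) * (a′ * d′) + (a * c * (a′ * b′) + b * d * (c′ * d′))
        ≈ (a * b′ + b * d′) * (c * a′ + d * c′)
    collect = solve 8 (λ a b c d a′ b′ c′ d′ →
      (a :* d) :* (b′ :* c′) :+ (b :* c) :* (a′ :* d′) :+ (a :* c :* (a′ :* b′) :+ b :* d :* (c′ :* d′))
        := (a :* b′ :+ b :* d′) :* (c :* a′ :+ d :* c′)) refl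

    expand : ∀ o u v e → (o + u) * (o + v) + (u * v + e) ≈ o * o + ((o + u) * v + u * (o + v) + e)
    expand = solve 4 (λ o u v e →
      (o :+ u) :* (o :+ v) :+ (u :* v :+ e) := o :* o :+ ((o :+ u) :* v :+ u :* (o :+ v) :+ e)) refl

    kernel : ∀ o b c d x y → o * x + b * (c * x + d * y) ≈ (o + b * c) * x + d * (b * y)
    kernel = solve 6 (λ o b c d x y →
      o :* x :+ b :* (c :* x :+ d :* y) := (o :+ b :* c) :* x :+ d :* (b :* y)) refl

    factor : ∀ a b d x y → (a * d) * x + d * (b * y) ≈ d * (a * x + b * y)
    factor = solve 5 (λ a b d x y →
      (a :* d) :* x :+ d :* (b :* y) := d :* (a :* x :+ b :* y)) refl

  module Determinants {c ℓ} (R : CommutativeRing c ℓ) where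

    open CommutativeRing R hiding (sym; trans)
    module R = CommutativeRing R
    module Id = Identities R
    open RingProperties R.ring using (-‿involutive)
    open SetoidReasoning setoid

    -- The semiring solver has no subtraction, so determinant hypotheses are put
    -- in the form ad ≈ 1 + bc.
    det⇒ : ∀ p q → p - q ≈ 1# → p ≈ 1# + q
    det⇒ p q eq = begin
      p               ≈⟨ +-identityʳ p ⟨
      p + 0#          ≈⟨ +-congˡ (-‿inverseˡ q) ⟨
      p + (- q + q)   ≈⟨ +-assoc p (- q) q ⟨
      (p - q) + q     ≈⟨ +-congʳ eq ⟩
      1# + q          ∎

    ⇒det : ∀ p q → p ≈ 1# + q → p - q ≈ 1#
    ⇒det p q eq = begin
      p - q           ≈⟨ +-congʳ eq ⟩
      (1# + q) - q    ≈⟨ +-assoc 1# q (- q) ⟩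
      1# + (q - q)    ≈⟨ +-congˡ (-‿inverseʳ q) ⟩
      1# + 0#         ≈⟨ +-identityʳ 1# ⟩
      1#              ∎

    det-1 : 1# * 1# - 0# * 0# ≈ 1#
    det-1 = ⇒det _ _ (R.trans (*-identityˡ 1#)
      (R.sym (R.trans (+-congˡ (zeroˡ 0#)) (+-identityʳ 1#))))

    det-letter : ∀ α → 0# * α - 1# * - 1# ≈ 1#
    det-letter α = begin
      0# * α - 1# * - 1#   ≈⟨ +-cong (zeroˡ α) (-‿cong (*-identityˡ (- 1#))) ⟩
      0# - - 1#            ≈⟨ +-identityˡ _ ⟩
      - - 1#               ≈⟨ -‿involutive 1# ⟩
      1#                   ∎

    det-∙ : ∀ a b c d a′ b′ c′ d′ → a * d - b * c ≈ 1# → a′ * d′ - b′ * c′ ≈ 1# →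
      (a * a′ + b * c′) * (c * b′ + d * d′) - (a * b′ + b * d′) * (c * a′ + d * c′) ≈ 1#
    det-∙ a b c d a′ b′ c′ d′ det det′ = ⇒det _ _ (begin
      (a * a′ + b * c′) * (c * b′ + d * d′)
        ≈⟨ Id.split a b c d a′ b′ c′ d′ ⟩
      (a * d) * (a′ * d′) + (u * v + e)
        ≈⟨ +-congʳ (*-cong ad a′d′) ⟩
      (1# + u) * (1# + v) + (u * v + e)
        ≈⟨ R.trans (Id.expand 1# u v e) (+-congʳ (*-identityˡ 1#)) ⟩
      1# + ((1# + u) * v + u * (1# + v) + e)
        ≈⟨ +-congˡ (+-congʳ (+-cong (*-congʳ ad) (*-congˡ a′d′))) ⟨
      1# + ((a * d) * v + u * (a′ * d′) + e)
        ≈⟨ +-congˡ (Id.collect a b c d a′ b′ c′ d′) ⟩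
      1# + (a * b′ + b * d′) * (c * a′ + d * c′)  ∎)
      where
      u v e : Carrier
      u = b * c
      v = b′ * c′
      e = a * c * (a′ * b′) + b * d * (c′ * d′)
      ad : a * d ≈ 1# + u
      ad = det⇒ _ _ det
      a′d′ : a′ * d′ ≈ 1# + v
      a′d′ = det⇒ _ _ det′

    kernel₁ : ∀ a b c d x y → a * d - b * c ≈ 1# →
      a * x + b * y ≈ 0# → c * x + d * y ≈ 0# → x ≈ 0#
    kernel₁ a b c d x y det p q = begin
      x                                ≈⟨ *-identityˡ x ⟨
      1# * x                           ≈⟨ +-identityʳ _ ⟨
      1# * x + 0#                      ≈⟨ +-congˡ (zeroʳ b) ⟨
      1# * x + b * 0#                  ≈⟨ +-congˡ (*-congˡ q) ⟨
      1# * x + b * (c * x + d * y)     ≈⟨ Id.kernel 1# b c d x y ⟩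
      (1# + b * c) * x + d * (b * y)   ≈⟨ +-congʳ (*-congʳ (det⇒ _ _ det)) ⟨
      (a * d) * x + d * (b * y)        ≈⟨ Id.factor a b d x y ⟩
      d * (a * x + b * y)              ≈⟨ *-congˡ p ⟩
      d * 0#                           ≈⟨ zeroʳ d ⟩
      0#                               ∎

    kernel₂ : ∀ a b c d x y → a * d - b * c ≈ 1# →
      a * x + b * y ≈ 0# → c * x + d * y ≈ 0# → y ≈ 0#
    kernel₂ a b c d x y det p q = kernel₁ d c b a y x
      (R.trans (+-cong (*-comm d a) (-‿cong (*-comm c b))) det)
      (R.trans (+-comm _ _) q) (R.trans (+-comm _ _) p)

module _ (N : ℕ) .{{nt : NonTrivial N}} where

  private
    instance
      N≢0 : NonZero N
      N≢0 = ℕ.nonTrivial⇒nonZero N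

  open CommutativeRing (ℤmod-commutativeRing N)
    using (_+_; _*_; -_; _-_; 0#; 1#)
  open AlgebraDefinitions {A = ℤmod N} _≡_ using (Invertible)

  private
    module Det = Determinants (ℤmod-commutativeRing N)

  -- mkSL₂ a b c d is the matrix with rows (a, b) and (c, d).
  record SL₂ : Set where
    constructor mkSL₂
    field
      a b c d : ℤmod N
      .det≡1  : a * d - b * c ≡ 1#

  1SL₂ : SL₂
  1SL₂ = mkSL₂ 1# 0# 0# 1# Det.det-1

  _∙_ : SL₂ → SL₂ → SL₂
  mkSL₂ a b c d p ∙ mkSL₂ a′ b′ c′ d′ p′ = mkSL₂
    (a * a′ + b * c′) (a * b′ + b * d′)
    (c * a′ + d * c′) (c * b′ + d * d′)
    (Det.det-∙ a b c d a′ b′ c′ d′ p p′)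

  letter : ℤmod N → SL₂
  letter α = mkSL₂ 0# 1# (- 1#) α (Det.det-letter α)

  π : List (ℤmod N) → SL₂
  π = foldr (λ α M → letter α ∙ M) 1SL₂

  record NonzeroVector : Set where
    constructor mkVector
    field
      x y      : ℤmod N
      .nonzero : (x , y) ≢ (0# , 0#)

  _·_ : SL₂ → NonzeroVector → NonzeroVector
  mkSL₂ a b c d det≡1 · mkVector x y nonzero =
    mkVector (a * x + b * y) (c * x + d * y) λ eq → nonzero (cong₂ _,_
      (Det.kernel₁ a b c d x y det≡1 (cong proj₁ eq) (cong proj₂ eq))
      (Det.kernel₂ a b c d x y det≡1 (cong proj₁ eq) (cong proj₂ eq)))

  infix 4 _∼′_
  _∼′_ : NonzeroVector → NonzeroVector → Set
  mkVector x y _ ∼′ mkVector x′ y′ _ =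
    ∃[ λ′ ] Invertible 1# _*_ λ′ × x ≡ λ′ * x′ × y ≡ λ′ * y′

  private
    1≢0 : 1# ≢ 0#
    1≢0 eq = contradiction (trans (sym (toℕ-% 1 (ℕ.nonTrivial⇒n>1 N)))
                             (trans (cong toℕ eq) (toℕ-% 0 (ℕ.>-nonZero⁻¹ N)))) λ ()
      where
      toℕ-% : ∀ k → k < N → toℕ (k mod N) ≡ k
      toℕ-% k k<N = trans (toℕ-fromℕ< (m%n<n k N)) (m<n⇒m%n≡m k<N)

  e₁ e₂ : NonzeroVector
  e₁ = mkVector 1# 0# λ eq → 1≢0 (cong proj₁ eq)
  e₂ = mkVector 0# 1# λ eq → 1≢0 (cong proj₂ eq)

  -- Two ∼′-classes are equal exactly when their representatives are related by ∼′.
  𝒜̄ : Pred (List (ℤmod N)) 0ℓ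
  𝒜̄ w = (π w · e₂) ∼′ e₁

InfiniteWord : ℕ → Set
InfiniteWord N = ℤ → ℤmod N

Periodic : ∀ {N} → ℕ → InfiniteWord N → Set
Periodic s W = ∀ i → W (i ℤ.+ + s) ≡ W i

subword : ∀ {N} → InfiniteWord N → ℤ → ℕ → List (ℤmod N)
subword W i m = applyUpTo (λ k → W (i ℤ.+ + k)) m

AllSubwords : ∀ {N} → ℕ → InfiniteWord N → Pred (List (ℤmod N)) 0ℓ → Set
AllSubwords m W P = ∀ i → subword W i m ∈ P

IsLeastPositive : Pred ℕ 0ℓ → Pred ℕ 0ℓ
IsLeastPositive P t = 0 < t × P t × (∀ t′ → 0 < t′ → P t′ → t ≤ t′)

{-# OPTIONS --safe #-}

-- If π(w) has bottom row (c, d), then w ∈ 𝒜̄ exactly when d = 0, while π(wα) has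
-- lower left entry -d; so w ∈ 𝒜̄ exactly when π(wα) is upper triangular.  Upper
-- triangular matrices are closed under products, so if all subwords of length ts map
-- to them then so do all subwords of length lts.  A suitable t exists because
-- SL₂(ℤ/N) is finite: two powers of the matrix of one period agree, so some positive
-- power t is the identity, and the matrices of the subwords of length ts at the other
-- positions are conjugate to it.  By periodicity only s positions matter, so the
-- property of t is decidable and there is a least such t.
module Submission where

open import Algebra.Bundles using (CommutativeRing)
import Algebra.Properties.Ring as RingProperties
import Algebra.Solver.Ring.NaturalCoefficients.Default as SemiringSolver
open import Data.Fin.Base as Fin using (Fin; toℕ; fromℕ<; combine)
open import Data.Fin.Properties as Fin
  using (toℕ-fromℕ<; combine-injective; pigeonhole; all?)
open import Data.Integer.Base as ℤ using (ℤ; +_; -[1+_])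
open import Data.Integer.DivMod using (_%ℕ_; _/ℕ_; n%ℕd<d; a≡a%ℕn+[a/ℕn]*n)
import Data.Integer.Properties as ℤ
import Data.Integer.Tactic.RingSolver as ℤ-Solver
open import Data.List.Base using ([]; _∷_; _++_; _∷ʳ_; applyUpTo)
open import Data.List.Properties using (applyUpTo-∷ʳ)
open import Data.Nat.Base as ℕ
  using (ℕ; zero; suc; NonZero; NonTrivial; _+_; _*_; _∸_; _≤_; _<_; z≤n; s≤s)
import Data.Nat.Properties as ℕ
open import Data.Product.Base using (_×_; _,_; ∃-syntax)
open import Function.Base using (_∘_)
open import Function.Bundles using (_⇔_; mk⇔; Equivalence)
open import Level using (0ℓ)
open import Relation.Binary.PropositionalEquality
  using (_≡_; refl; sym; trans; cong; cong₂; subst; module ≡-Reasoning)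
import Relation.Binary.Reasoning.Setoid as SetoidReasoning
open import Relation.Nullary.Decidable using (yes; no; map′; recompute)
open import Relation.Nullary.Negation using (contradiction)
open import Relation.Unary using (Pred; Decidable)
open import Defs

-- Least natural number with a decidable property.

least : ∀ {P : Pred ℕ 0ℓ} → Decidable P → ∀ n → P n → ∃[ m ] P m × (∀ k → P k → m ≤ k)
least P? zero    p = zero , p , λ _ _ → z≤n
least P? (suc n) p with P? zero
... | yes p₀ = zero , p₀ , λ _ _ → z≤n
... | no ¬p₀ with least (P? ∘ suc) n p
...   | m , pm , min = suc m , pm , λ where
        zero    p₀ → contradiction p₀ ¬p₀
        (suc k) pk → s≤s (min k pk)

-- Splitting and shifting subwords.

applyUpTo-+ : ∀ {A : Set} (f : ℕ → A) m n →
  applyUpTo f (m + n) ≡ applyUpTo f m ++ applyUpTo (λ k → f (m + k)) n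
applyUpTo-+ f zero    n = refl
applyUpTo-+ f (suc m) n = cong (f 0 ∷_) (applyUpTo-+ (f ∘ suc) m n)

applyUpTo-cong : ∀ {A : Set} {f g : ℕ → A} → (∀ k → f k ≡ g k) →
  ∀ n → applyUpTo f n ≡ applyUpTo g n
applyUpTo-cong eq zero    = refl
applyUpTo-cong eq (suc n) = cong₂ _∷_ (eq 0) (applyUpTo-cong (eq ∘ suc) n)

module _ {N : ℕ} (W : InfiniteWord N) where

  subword-+ : ∀ i m n → subword W i (m + n) ≡ subword W i m ++ subword W (i ℤ.+ + m) n
  subword-+ i m n = trans (applyUpTo-+ _ m n) (cong (subword W i m ++_)
    (applyUpTo-cong (λ k → cong W (sym (ℤ.+-assoc i (+ m) (+ k)))) n))

  subword-∷ʳ : ∀ i m → subword W i (suc m) ≡ subword W i m ∷ʳ W (i ℤ.+ + m)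
  subword-∷ʳ i m = sym (applyUpTo-∷ʳ _ m)

module _ {N s : ℕ} (W : InfiniteWord N) (periodic : Periodic s W) where

  periodic-ℕ : ∀ i q → W (i ℤ.+ + q ℤ.* + s) ≡ W i
  periodic-ℕ i zero    = cong W (ℤ.+-identityʳ i)
  periodic-ℕ i (suc q) = trans (cong W (shift i (+ q) (+ s)))
    (trans (periodic _) (periodic-ℕ i q))
    where
    shift : ∀ i q s → i ℤ.+ (+ 1 ℤ.+ q) ℤ.* s ≡ (i ℤ.+ q ℤ.* s) ℤ.+ s
    shift = ℤ-Solver.solve-∀

  periodic-ℤ : ∀ i q → W (i ℤ.+ q ℤ.* + s) ≡ W i
  periodic-ℤ i (+ q)    = periodic-ℕ i q
  -- Going forward again by `suc q` periods cancels the backward shift.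
  periodic-ℤ i -[1+ q ] = trans (sym (periodic-ℕ _ (suc q))) (cong W (undo i (+ suc q) (+ s)))
    where
    undo : ∀ i q s → (i ℤ.+ (ℤ.- q) ℤ.* s) ℤ.+ q ℤ.* s ≡ i
    undo = ℤ-Solver.solve-∀

  subword-periodic : ∀ i q n → subword W (i ℤ.+ q ℤ.* + s) n ≡ subword W i n
  subword-periodic i q = applyUpTo-cong λ k →
    trans (cong W (swap i (q ℤ.* + s) (+ k))) (periodic-ℤ (i ℤ.+ + k) q)
    where
    swap : ∀ i j k → (i ℤ.+ j) ℤ.+ k ≡ (i ℤ.+ k) ℤ.+ j
    swap = ℤ-Solver.solve-∀

  -- This leaves only the `s` starting positions below `s`, so a statement about all integer
  -- positions becomes finite.
  subword-% : .{{_ : NonZero s}} → ∀ i n → subword W i n ≡ subword W (+ (i %ℕ s)) n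
  subword-% i n = trans (cong (λ j → subword W j n) (a≡a%ℕn+[a/ℕn]*n i s))
    (subword-periodic (+ (i %ℕ s)) (i /ℕ s) n)

-- Identities between matrix entries, over an abstract ring so that modular arithmetic does not
-- unfold.

module Entries {c ℓ} (R : CommutativeRing c ℓ) where

  open CommutativeRing R using
    ( _≈_; -_; _-_; 0#; 1#; setoid; commutativeSemiring; +-cong; +-congˡ; +-congʳ
    ; +-identityˡ; +-identityʳ; *-congˡ; *-identityˡ; *-identityʳ; zeroˡ; zeroʳ; *-comm )
    renaming (_+_ to _⊕_; _*_ to _⊗_; refl to ≈-refl; sym to ≈-sym; trans to ≈-trans)
  open RingProperties (CommutativeRing.ring R)
    using (-1*x≈-x; -‿injective; -‿distribʳ-*; +-cancelʳ; -0#≈0#)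
  open SemiringSolver commutativeSemiring
  open SetoidReasoning setoid

  product-assoc : ∀ a b a′ b′ c′ d′ x y →
    (a ⊗ a′ ⊕ b ⊗ c′) ⊗ x ⊕ (a ⊗ b′ ⊕ b ⊗ d′) ⊗ y
      ≈ a ⊗ (a′ ⊗ x ⊕ b′ ⊗ y) ⊕ b ⊗ (c′ ⊗ x ⊕ d′ ⊗ y)
  product-assoc = solve 8 (λ a b a′ b′ c′ d′ x y →
    (a :* a′ :+ b :* c′) :* x :+ (a :* b′ :+ b :* d′) :* y
      := a :* (a′ :* x :+ b′ :* y) :+ b :* (c′ :* x :+ d′ :* y)) ≈-refl

  1x+0y≈x : ∀ x y → 1# ⊗ x ⊕ 0# ⊗ y ≈ x
  1x+0y≈x x y = ≈-trans (+-cong (*-identityˡ x) (zeroˡ y)) (+-identityʳ x)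

  0x+1y≈y : ∀ x y → 0# ⊗ x ⊕ 1# ⊗ y ≈ y
  0x+1y≈y x y = ≈-trans (+-cong (zeroˡ x) (*-identityˡ y)) (+-identityˡ y)

  x1+y0≈x : ∀ x y → x ⊗ 1# ⊕ y ⊗ 0# ≈ x
  x1+y0≈x x y = ≈-trans (+-cong (*-identityʳ x) (zeroʳ y)) (+-identityʳ x)

  x0+y1≈y : ∀ x y → x ⊗ 0# ⊕ y ⊗ 1# ≈ y
  x0+y1≈y x y = ≈-trans (+-cong (zeroʳ x) (*-identityʳ y)) (+-identityˡ y)

  x0+y[-1]≈-y : ∀ x y → x ⊗ 0# ⊕ y ⊗ (- 1#) ≈ - y
  x0+y[-1]≈-y x y = ≈-trans
    (+-cong (zeroʳ x) (≈-trans (*-comm y (- 1#)) (-1*x≈-x y))) (+-identityˡ (- y))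

  0x+y0≈0 : ∀ x y → 0# ⊗ x ⊕ y ⊗ 0# ≈ 0#
  0x+y0≈0 x y = ≈-trans (+-cong (zeroˡ x) (zeroʳ y)) (+-identityˡ 0#)

  x0+y[-1]≈0⇒y≈0 : ∀ x y → x ⊗ 0# ⊕ y ⊗ (- 1#) ≈ 0# → y ≈ 0#
  x0+y[-1]≈0⇒y≈0 x y eq = -‿injective
    (≈-trans (≈-sym (x0+y[-1]≈-y x y)) (≈-trans eq (≈-sym -0#≈0#)))

  x0+0[-1]≈0 : ∀ x → x ⊗ 0# ⊕ 0# ⊗ (- 1#) ≈ 0#
  x0+0[-1]≈0 x = ≈-trans (x0+y[-1]≈-y x 0#) -0#≈0#

  x0+y1≈z0⇒y≈0 : ∀ x y z → x ⊗ 0# ⊕ y ⊗ 1# ≈ z ⊗ 0# → y ≈ 0#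
  x0+y1≈z0⇒y≈0 x y z eq = ≈-trans (≈-sym (x0+y1≈y x y)) (≈-trans eq (zeroʳ z))

  x0+y1≈y1 : ∀ x y → x ⊗ 0# ⊕ y ⊗ 1# ≈ y ⊗ 1#
  x0+y1≈y1 x y = ≈-trans (x0+y1≈y x y) (≈-sym (*-identityʳ y))

  x0+01≈y0 : ∀ x y → x ⊗ 0# ⊕ 0# ⊗ 1# ≈ y ⊗ 0#
  x0+01≈y0 x y = ≈-trans (x0+y1≈y x 0#) (≈-sym (zeroʳ y))

  cancel-bottom : ∀ x y x′ y′ → 0# ⊗ x ⊕ 1# ⊗ y ≈ 0# ⊗ x′ ⊕ 1# ⊗ y′ → y ≈ y′
  cancel-bottom x y x′ y′ eq = ≈-trans (≈-sym (0x+1y≈y x y)) (≈-trans eq (0x+1y≈y x′ y′))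

  -- The second row of a letter matrix is `(- 1# , α)`: once the bottom entries of two columns
  -- agree, their `α` terms cancel and leave the negated top entries.
  cancel-top : ∀ α x x′ y y′ → y ≈ y′ → (- 1#) ⊗ x ⊕ α ⊗ y ≈ (- 1#) ⊗ x′ ⊕ α ⊗ y′ → x ≈ x′
  cancel-top α x x′ y y′ y≈y′ eq = -‿injective (≈-trans (≈-sym (-1*x≈-x x))
    (≈-trans (+-cancelʳ (α ⊗ y) _ _ (≈-trans eq (+-congˡ (*-congˡ (≈-sym y≈y′))))) (-1*x≈-x x′)))

  det-d≈0 : ∀ a b c → a ⊗ 0# - b ⊗ c ≈ 1# → b ⊗ (- c) ≈ 1#
  det-d≈0 a b c det = begin
    b ⊗ (- c)        ≈⟨ -‿distribʳ-* b c ⟨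
    - (b ⊗ c)        ≈⟨ +-identityˡ _ ⟨
    0# - b ⊗ c       ≈⟨ +-congʳ (zeroʳ a) ⟨
    a ⊗ 0# - b ⊗ c   ≈⟨ det ⟩
    1#               ∎

-- Matrices of words.

module Words (N : ℕ) .{{nt : NonTrivial N}} where

  private
    instance
      N≢0 : NonZero N
      N≢0 = ℕ.nonTrivial⇒nonZero N

    ℤ/N : CommutativeRing 0ℓ 0ℓ
    ℤ/N = ℤmod-commutativeRing N

    infixr 7 _⋆_
    _⋆_ : SL₂ N → SL₂ N → SL₂ N
    _⋆_ = _∙_ N

  open CommutativeRing ℤ/N using (-_; 0#; 1#; *-comm)
  open Entries ℤ/N

  SL₂-≡ : ∀ {A B : SL₂ N} → SL₂.a A ≡ SL₂.a B → SL₂.b A ≡ SL₂.b B →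
    SL₂.c A ≡ SL₂.c B → SL₂.d A ≡ SL₂.d B → A ≡ B
  SL₂-≡ refl refl refl refl = refl

  ⋆-assoc : ∀ A B C → (A ⋆ B) ⋆ C ≡ A ⋆ (B ⋆ C)
  ⋆-assoc (mkSL₂ a b c d _) (mkSL₂ a′ b′ c′ d′ _) (mkSL₂ x y z t _) = SL₂-≡
    (product-assoc a b a′ b′ c′ d′ x z) (product-assoc a b a′ b′ c′ d′ y t)
    (product-assoc c d a′ b′ c′ d′ x z) (product-assoc c d a′ b′ c′ d′ y t)

  ⋆-identityˡ : ∀ A → 1SL₂ N ⋆ A ≡ A
  ⋆-identityˡ (mkSL₂ a b c d _) =
    SL₂-≡ (1x+0y≈x a c) (1x+0y≈x b d) (0x+1y≈y a c) (0x+1y≈y b d)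

  ⋆-identityʳ : ∀ A → A ⋆ 1SL₂ N ≡ A
  ⋆-identityʳ (mkSL₂ a b c d _) =
    SL₂-≡ (x1+y0≈x a b) (x0+y1≈y a b) (x1+y0≈x c d) (x0+y1≈y c d)

  -- Cancellation stands in for inverse matrices. The top row of the product is the bottom row of
  -- the right factor; once that is known, the bottom row of the product yields the top one.
  letter-cancelˡ : ∀ α A B → letter N α ⋆ A ≡ letter N α ⋆ B → A ≡ B
  letter-cancelˡ α (mkSL₂ a b c d _) (mkSL₂ a′ b′ c′ d′ _) eq = SL₂-≡
    (cancel-top α a a′ c c′ c≡c′ (cong SL₂.c eq)) (cancel-top α b b′ d d′ d≡d′ (cong SL₂.d eq)) c≡c′ d≡d′
    where
    c≡c′ : c ≡ c′
    c≡c′ = cancel-bottom a c a′ c′ (cong SL₂.a eq)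
    d≡d′ : d ≡ d′
    d≡d′ = cancel-bottom b d b′ d′ (cong SL₂.b eq)

  π-++ : ∀ u v → π N (u ++ v) ≡ π N u ⋆ π N v
  π-++ []      v = sym (⋆-identityˡ (π N v))
  π-++ (α ∷ u) v = trans (cong (letter N α ⋆_) (π-++ u v))
    (sym (⋆-assoc (letter N α) (π N u) (π N v)))

  π-[_] : ∀ α → π N (α ∷ []) ≡ letter N α
  π-[ α ] = ⋆-identityʳ (letter N α)

  π-∷ʳ : ∀ u α → π N (u ∷ʳ α) ≡ π N u ⋆ letter N α
  π-∷ʳ u α = trans (π-++ u (α ∷ [])) (cong (π N u ⋆_) π-[ α ])

  π-cancelˡ : ∀ u A B → π N u ⋆ A ≡ π N u ⋆ B → A ≡ B
  π-cancelˡ []      A B eq = trans (sym (⋆-identityˡ A)) (trans eq (⋆-identityˡ B))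
  π-cancelˡ (α ∷ u) A B eq = π-cancelˡ u A B (letter-cancelˡ α (π N u ⋆ A) (π N u ⋆ B)
    (trans (sym (⋆-assoc (letter N α) (π N u) A)) (trans eq (⋆-assoc (letter N α) (π N u) B))))

  -- The four entries suffice, since the determinant proof is irrelevant; this embeds the group in a
  -- finite set.
  code : SL₂ N → Fin (N * (N * (N * N)))
  code (mkSL₂ a b c d _) = combine a (combine b (combine c d))

  code-injective : ∀ {A B} → code A ≡ code B → A ≡ B
  code-injective {mkSL₂ a b c d _} {mkSL₂ a′ b′ c′ d′ _} eq =
    let a≡ , eq₁ = combine-injective a _ a′ _ eq
        b≡ , eq₂ = combine-injective b _ b′ _ eq₁
        c≡ , d≡  = combine-injective c d c′ d′ eq₂
    in SL₂-≡ a≡ b≡ c≡ d≡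

  SL₂-pigeonhole : (f : ℕ → SL₂ N) → ∃[ m ] ∃[ n ] m < n × f m ≡ f n
  SL₂-pigeonhole f =
    -- Exponents range over one more value than there are codes.
    let i , j , i<j , eq = pigeonhole (ℕ.n<1+n _) (code ∘ f ∘ toℕ)
    in toℕ i , toℕ j , i<j , code-injective eq

  -- Upper triangular matrices and `𝒜̄`.

  UpperTriangular : SL₂ N → Set
  UpperTriangular M = SL₂.c M ≡ 0#

  UpperTriangular-⋆ : ∀ A B → UpperTriangular A → UpperTriangular B → UpperTriangular (A ⋆ B)
  UpperTriangular-⋆ (mkSL₂ a b c d _) (mkSL₂ a′ b′ c′ d′ _) refl refl = 0x+y0≈0 a′ d

  ·e₂∼e₁⇔d≡0 : ∀ M → _∼′_ N (_·_ N M (e₂ N)) (e₁ N) ⇔ SL₂.d M ≡ 0#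
  ·e₂∼e₁⇔d≡0 (mkSL₂ a b c d det) = mk⇔
    (λ { (l , _ , _ , eq) → x0+y1≈z0⇒y≈0 c d l eq })
    -- With d = 0 the determinant is -bc = 1, so the scalar `b` is a unit with inverse `- c`. The
    -- irrelevant determinant proof is recovered by decidable equality.
    (λ { refl → let -bc≡1 = det-d≈0 a b c (recompute (_ Fin.≟ 1#) det) in
      b , (- c , trans (*-comm (- c) b) -bc≡1 , -bc≡1) , x0+y1≈y1 a b , x0+01≈y0 c b })

  ⋆letter-upper⇔d≡0 : ∀ M α → UpperTriangular (M ⋆ letter N α) ⇔ SL₂.d M ≡ 0#
  ⋆letter-upper⇔d≡0 (mkSL₂ a b c d _) α = mk⇔ (x0+y[-1]≈0⇒y≈0 c d) (λ { refl → x0+0[-1]≈0 c })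

  -- Any letter will do: `α` enters only the right column of the product.
  𝒜̄⇔upper : ∀ w α → 𝒜̄ N w ⇔ UpperTriangular (π N (w ∷ʳ α))
  𝒜̄⇔upper w α = mk⇔
    (λ w∈𝒜̄ → trans c≡ (L.from (E.to w∈𝒜̄)))
    (λ upper → E.from (L.to (trans (sym c≡) upper)))
    where
    module E = Equivalence (·e₂∼e₁⇔d≡0 (π N w))
    module L = Equivalence (⋆letter-upper⇔d≡0 (π N w) α)
    c≡ : SL₂.c (π N (w ∷ʳ α)) ≡ SL₂.c (π N w ⋆ letter N α)
    c≡ = cong SL₂.c (π-∷ʳ w α)

  module _ (W : InfiniteWord N) where

    AllUpper : ℕ → Set
    AllUpper n = ∀ i → UpperTriangular (π N (subword W i n))

    -- The appended letter is the next one of `W`, so length `n` turns into `suc n`.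
    all𝒜̄⇔allUpper : ∀ n → AllSubwords n W (𝒜̄ N) ⇔ AllUpper (suc n)
    all𝒜̄⇔allUpper n = mk⇔
      (λ all i → trans (c≡ i) (Equivalence.to (last-letter i) (all i)))
      (λ all i → Equivalence.from (last-letter i) (trans (sym (c≡ i)) (all i)))
      where
      last-letter = λ i → 𝒜̄⇔upper (subword W i n) (W (i ℤ.+ + n))
      c≡ : ∀ i → SL₂.c (π N (subword W i (suc n))) ≡ SL₂.c (π N (subword W i n ∷ʳ W (i ℤ.+ + n)))
      c≡ i = cong (SL₂.c ∘ π N) (subword-∷ʳ W i n)

    π-subword-+ : ∀ i m n →
      π N (subword W i (m + n)) ≡ π N (subword W i m) ⋆ π N (subword W (i ℤ.+ + m) n)
    π-subword-+ i m n = trans (cong (π N) (subword-+ W i m n)) (π-++ (subword W i m) _)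

    AllUpper-+ : ∀ m n → AllUpper m → AllUpper n → AllUpper (m + n)
    AllUpper-+ m n p q i = trans (cong SL₂.c (π-subword-+ i m n))
      (UpperTriangular-⋆ (π N (subword W i m)) (π N (subword W (i ℤ.+ + m) n)) (p i) (q (i ℤ.+ + m)))

    AllUpper-* : ∀ l {n} → AllUpper n → AllUpper (l * n)
    -- The empty word maps to the identity matrix.
    AllUpper-* zero    p i = refl
    AllUpper-* (suc l) {n} p = AllUpper-+ n (l * n) p (AllUpper-* l p)

    -- Periodic words: decidability and existence of an exponent.

    module _ {s : ℕ} .{{s≢0 : NonZero s}} (periodic : Periodic s W) where

      AllUpper? : Decidable AllUpper
      AllUpper? n = map′
        (λ f i → trans
          (cong (SL₂.c ∘ π N) (trans (subword-% W periodic i n)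
            (cong (λ k → subword W (+ k) n) (sym (toℕ-fromℕ< (n%ℕd<d i s))))))
          (f (fromℕ< (n%ℕd<d i s))))
        (λ all r → all (+ toℕ r))
        (all? {n = s} λ r → SL₂.c (π N (subword W (+ toℕ r) n)) Fin.≟ 0#)

      -- Conjugation by one letter, without inverses: the subword of length `t * s + 1` at `k`
      -- splits off its first or its last letter. These letters agree by periodicity, so the block
      -- at `suc k` can be isolated by cancelling on the left.
      π≡1-suc : ∀ t k → π N (subword W (+ k) (t * s)) ≡ 1SL₂ N →
        π N (subword W (+ suc k) (t * s)) ≡ 1SL₂ N
      π≡1-suc t k eq = π-cancelˡ (subword W (+ k) 1) (π N (subword W (+ suc k) n)) (1SL₂ N) (begin
        α ⋆ π N (subword W (+ suc k) n)                   ≡⟨ cong (λ j → α ⋆ π N (subword W (+ j) n)) (ℕ.+-comm 1 k) ⟩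
        α ⋆ π N (subword W (+ k ℤ.+ + 1) n)               ≡⟨ π-subword-+ (+ k) 1 n ⟨
        π N (subword W (+ k) (1 + n))                     ≡⟨ cong (λ m → π N (subword W (+ k) m)) (ℕ.+-comm 1 n) ⟩
        π N (subword W (+ k) (n + 1))                     ≡⟨ π-subword-+ (+ k) n 1 ⟩
        π N (subword W (+ k) n) ⋆ π N (subword W (+ k ℤ.+ + n) 1)
          ≡⟨ cong₂ _⋆_ eq (cong (π N) (trans (cong (λ j → subword W (+ k ℤ.+ j) 1) (ℤ.pos-* t s))
               (subword-periodic W periodic (+ k) (+ t) 1))) ⟩
        1SL₂ N ⋆ α                                        ≡⟨ trans (⋆-identityˡ α) (sym (⋆-identityʳ α)) ⟩
        α ⋆ 1SL₂ N                                        ∎)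
        where
        open ≡-Reasoning
        n : ℕ
        n = t * s
        α : SL₂ N
        α = π N (subword W (+ k) 1)

      π≡1-ℕ : ∀ t → π N (subword W (+ 0) (t * s)) ≡ 1SL₂ N →
        ∀ k → π N (subword W (+ k) (t * s)) ≡ 1SL₂ N
      π≡1-ℕ t eq zero    = eq
      π≡1-ℕ t eq (suc k) = π≡1-suc t k (π≡1-ℕ t eq k)

      -- The `n`-th power of the matrix of one period, written as the matrix of a word so that
      -- `π-cancelˡ` applies.
      power : ℕ → SL₂ N
      power n = π N (subword W (+ 0) (n * s))

      power-+ : ∀ m n → power (m + n) ≡ power m ⋆ power n
      power-+ m n = begin
        power (m + n)
          ≡⟨ cong (λ l → π N (subword W (+ 0) l)) (ℕ.*-distribʳ-+ s m n) ⟩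
        π N (subword W (+ 0) (m * s + n * s))
          ≡⟨ π-subword-+ (+ 0) (m * s) (n * s) ⟩
        power m ⋆ π N (subword W (+ 0 ℤ.+ + (m * s)) (n * s))
          ≡⟨ cong (λ j → power m ⋆ π N (subword W (+ 0 ℤ.+ j) (n * s))) (ℤ.pos-* m s) ⟩
        power m ⋆ π N (subword W (+ 0 ℤ.+ + m ℤ.* + s) (n * s))
          ≡⟨ cong (λ w → power m ⋆ π N w) (subword-periodic W periodic (+ 0) (+ m) (n * s)) ⟩
        power m ⋆ power n  ∎
        where open ≡-Reasoning

      power-collision : ∀ m n → power m ≡ power (m + n) → power n ≡ 1SL₂ N
      power-collision m n eq = sym (π-cancelˡ (subword W (+ 0) (m * s)) (1SL₂ N) (power n)
        (trans (⋆-identityʳ (power m)) (trans eq (power-+ m n))))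

      ∃-power≡1 : ∃[ t ] power (suc t) ≡ 1SL₂ N
      ∃-power≡1 =
        let m , n , m<n , eq = SL₂-pigeonhole power
            -- Here `m<n` reads `suc m ≤ n`, so the gap between the exponents is `suc t`, hence
            -- positive.
            t , m+t≡n        = ℕ.m≤n⇒∃[o]m+o≡n m<n
        in t , power-collision m (suc t)
             (trans eq (cong power (trans (sym m+t≡n) (sym (ℕ.+-suc m t)))))

      ∃-AllUpper : ∃[ t ] AllUpper (suc t * s)
      ∃-AllUpper = let t , eq = ∃-power≡1 in t , λ i → cong SL₂.c
        (trans (cong (π N) (subword-% W periodic i (suc t * s))) (π≡1-ℕ (suc t) eq (i %ℕ s)))

      -- Positivity of `t` and `s` makes the truncated subtraction a true predecessor.
      all𝒜̄-∸1 : ∀ t → 0 < t → AllSubwords (t * s ∸ 1) W (𝒜̄ N) ⇔ AllUpper (t * s)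
      all𝒜̄-∸1 (suc t) _ = subst (λ n → AllSubwords (suc t * s ∸ 1) W (𝒜̄ N) ⇔ AllUpper n)
        (ℕ.suc-pred (suc t * s) {{ℕ.m*n≢0 (suc t) s}})
        (all𝒜̄⇔allUpper (suc t * s ∸ 1))

theorem5p5 : (N s : ℕ) .{{_ : NonTrivial N}} .{{_ : NonZero s}} (W : InfiniteWord N) → Periodic s W →
    ∃[ t ] IsLeastPositive (λ t′ → AllSubwords (t′ * s ∸ 1) W (𝒜̄ N)) t
    × (∀ l → 1 ≤ l → AllSubwords (l * t * s ∸ 1) W (𝒜̄ N))
theorem5p5 N s W periodic =
  let t₀ , upper₀     = ∃-AllUpper W periodic
      -- The search runs over predecessors, so the exponent `suc t` is positive by construction.
      t , upper , min = least (λ t → AllUpper? W periodic (suc t * s)) t₀ upper₀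
  in suc t
   , ( s≤s z≤n
     , E.from (suc t) (s≤s z≤n) upper
     , λ { (suc t′) 0<t′ all → s≤s (min t′ (E.to (suc t′) 0<t′ all)) })
   , λ l 1≤l → E.from (l * suc t) (ℕ.*-mono-≤ 1≤l (s≤s z≤n))
       (subst (AllUpper W) (sym (ℕ.*-assoc l (suc t) s)) (AllUpper-* W l upper))
  where
  open Words N
  module E t (0<t : 0 < t) = Equivalence (all𝒜̄-∸1 W periodic t 0<t)
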